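{- Let $n\geq 4$ and $m=\lfloor (n-2)/2\rfloor$. Then \[R_n(z)=(1+z)^m\sum_{q} z^{\mathrm{run}(q)},\] where the sum is over all permutations $q$ of length $n$ that are minimal in their orbit under the action of $G_m$. In particular, $R_n(z)$ is divisible by $(1+z)^m$.
   Context: For a permutation $p=p_1p_2\cdots p_n$ and an index $i\in[2,n-1]$, $p$ changes direction at $i$ if $p_{i-1}<p_i>p_{i+1}$ or $p_{i-1}>p_i<p_{i+1}$; $\mathrm{run}(p)=k$ means $p$ changes direction exactly $k-1$ times (the number of alternating runs). $R_n(z)=\sum_p z^{\mathrm{run}(p)}$, summed over all permutations $p$ of length $n$. For a string $s$ of distinct integers with underlying set $S$, its complement relative to $S$ is obtained by replacing, for each $j$, the $j$th smallest element of $S$ by the $j$th largest element of $S$. For $1\leq i\leq n$, $c_i$ is the map on permutations of length $n$ that leaves $p_1\cdots p_{i-1}$ unchanged and replaces $p_ip_{i+1}\cdots p_n$ by its complement relative to $\{p_i,\dots,p_n\}$. If $n$ is even, $\mathcal C_n=\{c_3,c_5,\dots,c_{n-1}\}$; if $n$ is odd, $\mathcal C_n=\{c_3,c_5,\dots,c_{n-2}\}$; $G_m\cong(\mathbb Z_2)^m$ is the group generated by $\mathcal C_n$ (these are pairwise commuting involutions), acting on permutations of length $n$. A permutation $q$ is minimal in its orbit if it has the smallest number of alternating runs among all permutations in its $G_m$-orbit (there is exactly one such permutation in each orbit). -}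

module Defs where

open import Algebra.Bundles.Raw using (RawSemiring)
import Algebra.Definitions.RawSemiring as RawSemiringDefinitions
open import Data.Bool using (if_then_else_)
open import Data.Fin as Fin using (Fin; fromℕ<)
import Data.Fin.Properties as Fin
open import Data.Integer as ℤ using (ℤ)
open import Data.List as List using (List; []; _∷_; _++_)
open import Data.List.Membership.Propositional using () renaming (_∈_ to _∈ₗ_)
open import Data.List.Membership.Propositional.Properties using (∈-++⁺ˡ; ∈-++⁺ʳ; ∈-++⁻; ∈-map⁺; ∈-map⁻; ∈-filter⁺; ∈-filter⁻; ∈-upTo⁺)
open import Data.List.Relation.Unary.All as ListAll using ()
open import Data.List.Relation.Unary.Any using (here; there)
open import Data.Maybe using (Maybe; just; nothing; fromMaybe)
open import Data.Nat as ℕ using (ℕ; zero; suc; _+_; _∸_; _≤_; _<_)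
open import Data.Nat.Divisibility using (_∣_; _∣?_)
import Data.Nat.Properties as ℕ
open import Data.Product using (Σ-syntax; ∃-syntax; _×_; _,_; proj₁; proj₂)
open import Data.Sum using (_⊎_; inj₁; inj₂)
open import Data.Vec as Vec using (Vec; []; _∷_; count; toList)
open import Data.Vec.Membership.Propositional using (_∈_)
import Data.Vec.Membership.Propositional.Properties as Vec
open import Data.Vec.Relation.Unary.All as All using (All; []; _∷_)
open import Data.Vec.Relation.Unary.AllPairs using (allPairs?)
open import Data.Vec.Relation.Unary.Any as Any using (here; there)
open import Data.Vec.Relation.Unary.Unique.Propositional using (Unique; []; _∷_)
import Data.Vec.Relation.Unary.Unique.Propositional.Properties as Unique
open import Function using (_∘_; id)
open import Function.Definitions using (Inverseᵇ; Injective)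
open import Level using (0ℓ)
open import Relation.Binary.Definitions using (tri<; tri≈; tri>)
open import Relation.Binary.PropositionalEquality
open import Relation.Nullary using (¬_; Dec; does; yes; no; recompute; contradiction; ¬?; _×-dec_; _⊎-dec_; map′)
open import Relation.Unary using (Pred; Decidable)

-- [a₀, a₁, …] stands for a₀ + a₁z + ⋯; trailing zeros are allowed, so
-- equality is equality of all coefficients.

Poly : Set
Poly = List ℤ

coeff : Poly → ℕ → ℤ
coeff []      _       = ℤ.0ℤ
coeff (a ∷ _) zero    = a
coeff (_ ∷ f) (suc k) = coeff f k

_≈ₚ_ : Poly → Poly → Set
f ≈ₚ g = ∀ k → coeff f k ≡ coeff g k

_+ₚ_ : Poly → Poly → Poly
[]      +ₚ g       = g
(a ∷ f) +ₚ []      = a ∷ f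
(a ∷ f) +ₚ (b ∷ g) = (a ℤ.+ b) ∷ (f +ₚ g)

_*ₚ_ : Poly → Poly → Poly
[]      *ₚ g = []
(a ∷ f) *ₚ g = List.map (a ℤ.*_) g +ₚ (ℤ.0ℤ ∷ (f *ₚ g))

ℤ[z] : RawSemiring 0ℓ 0ℓ
ℤ[z] = record
  { Carrier = Poly
  ; _≈_     = _≈ₚ_
  ; _+_     = _+ₚ_
  ; _*_     = _*ₚ_
  ; 0#      = []
  ; 1#      = ℤ.1ℤ ∷ []
  }

module Polynomial where
  open RawSemiring ℤ[z] public using (_≈_; _+_; _*_; 0#; 1#)
  open RawSemiringDefinitions ℤ[z] public using (_^_; _∣_)

  z : Poly
  z = ℤ.0ℤ ∷ ℤ.1ℤ ∷ []

  ∑ : {A : Set} → List A → (A → Poly) → Poly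
  ∑ xs f = List.foldr _+ₚ_ [] (List.map f xs)

private
  variable
    n k : ℕ

-- x is the j-th smallest entry of s when smaller x s ≡ j ∸ 1, and the
-- j-th largest when larger x s ≡ j ∸ 1.

smaller larger : Fin n → Vec (Fin n) k → ℕ
smaller x s = count (Fin._<? x) s
larger  x s = count (x Fin.<?_) s

-- The default is never used when s has distinct entries and x is one
-- of them (see opposite-spec).

opposite : Vec (Fin n) k → Fin n → Fin n
opposite s x =
  fromMaybe x (List.find (λ y → larger y s ℕ.≟ smaller x s) (toList s))

complement : Vec (Fin n) k → Vec (Fin n) k
complement s = Vec.map (opposite s) s

complementAfter : ℕ → Vec (Fin n) k → Vec (Fin n) k
complementAfter zero    s       = complement s
complementAfter (suc j) []      = []
complementAfter (suc j) (x ∷ s) = x ∷ complementAfter j s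

unique? : Decidable (Unique {A = Fin n} {k})
unique? = allPairs? (λ x y → ¬? (x Fin.≟ y))

module _ {A : Set} {P Q : Pred A 0ℓ} (P? : Decidable P) (Q? : Decidable Q) where

  count-mono : {s : Vec A k} → (∀ {x} → x ∈ s → P x → Q x) → count P? s ≤ count Q? s
  count-mono {s = []}    P⇒Q = ℕ.z≤n
  count-mono {s = x ∷ s} P⇒Q with P? x | Q? x
  ... | yes _ | yes _ = ℕ.s≤s (count-mono (P⇒Q ∘ there))
  ... | yes p | no ¬q = contradiction (P⇒Q (here refl) p) ¬q
  ... | no  _ | yes _ = ℕ.m≤n⇒m≤1+n (count-mono (P⇒Q ∘ there))
  ... | no  _ | no  _ = count-mono (P⇒Q ∘ there)

  count-strict : {s : Vec A k} → (∀ {x} → x ∈ s → P x → Q x) →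
                 ∀ {y} → y ∈ s → ¬ P y → Q y → count P? s < count Q? s
  count-strict {s = x ∷ s} P⇒Q y∈ ¬Py Qy with P? x | Q? x | y∈
  ... | yes p | _     | here refl = contradiction p ¬Py
  ... | no  _ | no ¬q | here refl = contradiction Qy ¬q
  ... | no  _ | yes _ | here refl = ℕ.s≤s (count-mono (P⇒Q ∘ there))
  ... | yes _ | yes _ | there y∈s = ℕ.s≤s (count-strict (P⇒Q ∘ there) y∈s ¬Py Qy)
  ... | yes p | no ¬q | there y∈s = contradiction (P⇒Q (here refl) p) ¬q
  ... | no  _ | yes _ | there y∈s = ℕ.m≤n⇒m≤1+n (count-strict (P⇒Q ∘ there) y∈s ¬Py Qy)
  ... | no  _ | no  _ | there y∈s = count-strict (P⇒Q ∘ there) y∈s ¬Py Qy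

count-cong : {A : Set} {P Q : Pred A 0ℓ} (P? : Decidable P) (Q? : Decidable Q) {s : Vec A k} →
             (∀ {x} → x ∈ s → P x → Q x) → (∀ {x} → x ∈ s → Q x → P x) →
             count P? s ≡ count Q? s
count-cong P? Q? f g = ℕ.≤-antisym (count-mono P? Q? f) (count-mono Q? P? g)

count-map : {A : Set} {P : Pred A 0ℓ} (P? : Decidable P) (f : A → A) (s : Vec A k) →
            count P? (Vec.map f s) ≡ count (P? ∘ f) s
count-map P? f []      = refl
count-map P? f (x ∷ s) with P? (f x)
... | yes _ = cong suc (count-map P? f s)
... | no  _ = count-map P? f s

extract : {A : Set} {x : A} {s : Vec A (suc k)} → x ∈ s →
          Σ[ t ∈ Vec A k ] (∀ {P : Pred A 0ℓ} (P? : Decidable P) → count P? s ≡ count P? (x ∷ t))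
               × (∀ {y} → y ∈ s → y ≡ x ⊎ y ∈ t)
extract {s = x ∷ s} (here refl) =
  s , (λ _ → refl) , λ { (here eq) → inj₁ eq ; (there y∈s) → inj₂ y∈s }
extract {k = suc k} {x = x} {s = w ∷ s} (there x∈s) with t , same , split ← extract x∈s =
  w ∷ t , same′ , λ { (here eq) → inj₂ (here eq) ; (there y∈s) → split′ (split y∈s) }
  where
  split′ : ∀ {y} → y ≡ x ⊎ y ∈ t → y ≡ x ⊎ y ∈ (w ∷ t)
  split′ (inj₁ eq) = inj₁ eq
  split′ (inj₂ y∈) = inj₂ (there y∈)
  same′ : ∀ {P} (P? : Decidable P) → count P? (w ∷ s) ≡ count P? (x ∷ w ∷ t)
  same′ P? with P? w | P? x | same P?
  ... | yes _ | yes _ | eq = cong suc eq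
  ... | yes _ | no  _ | eq = cong suc eq
  ... | no  _ | yes _ | eq = eq
  ... | no  _ | no  _ | eq = eq

count-⊆ : {A : Set} {s t : Vec A k} → Unique s → (∀ {x} → x ∈ s → x ∈ t) →
          ∀ {P : Pred A 0ℓ} (P? : Decidable P) → count P? s ≡ count P? t
count-⊆ {s = []}    {[]} _         s⊆t P? = refl
count-⊆ {s = x ∷ s} {t}  (x∉s ∷ u) s⊆t P?
  with t′ , same , split ← extract (s⊆t (here refl)) = trans step (sym (same P?))
  where
  s⊆t′ : ∀ {y} → y ∈ s → y ∈ t′
  s⊆t′ y∈s with split (s⊆t (there y∈s))
  ... | inj₁ refl = contradiction refl (All.lookup x∉s y∈s)
  ... | inj₂ y∈t′ = y∈t′
  step : count P? (x ∷ s) ≡ count P? (x ∷ t′)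
  step with P? x
  ... | yes _ = cong suc (count-⊆ u s⊆t′ P?)
  ... | no  _ = count-⊆ u s⊆t′ P?

smaller-< : {s : Vec (Fin n) k} {x y : Fin n} → x ∈ s → x Fin.< y → smaller x s < smaller y s
smaller-< {x = x} {y} x∈s x<y =
  count-strict (Fin._<? x) (Fin._<? y) (λ _ w<x → Fin.<-trans w<x x<y) x∈s (Fin.<-irrefl refl) x<y

larger-< : {s : Vec (Fin n) k} {x y : Fin n} → y ∈ s → x Fin.< y → larger y s < larger x s
larger-< {x = x} {y} y∈s x<y =
  count-strict (y Fin.<?_) (x Fin.<?_) (λ _ y<w → Fin.<-trans x<y y<w) y∈s (Fin.<-irrefl refl) x<y

larger-injective : {s : Vec (Fin n) k} {x y : Fin n} → x ∈ s → y ∈ s →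
                   larger x s ≡ larger y s → x ≡ y
larger-injective {x = x} {y} x∈s y∈s eq with Fin.<-cmp x y
... | tri< x<y _ _ = contradiction (sym eq) (ℕ.<⇒≢ (larger-< y∈s x<y))
... | tri≈ _ x≡y _ = x≡y
... | tri> _ _ y<x = contradiction eq (ℕ.<⇒≢ (larger-< x∈s y<x))

larger-reflects-< : {s : Vec (Fin n) k} {x y : Fin n} → x ∈ s → y ∈ s →
                    larger y s < larger x s → x Fin.< y
larger-reflects-< {x = x} {y} x∈s y∈s lt with Fin.<-cmp x y
... | tri< x<y _ _  = x<y
... | tri≈ _ refl _ = contradiction lt (ℕ.<-irrefl refl)
... | tri> _ _ y<x  = contradiction lt (ℕ.<-asym (larger-< x∈s y<x))

module _ {A : Set} {P : Pred A 0ℓ} (P? : Decidable P) {s : Vec A k} {x : A} where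

  count-yes : P x → count P? (x ∷ s) ≡ suc (count P? s)
  count-yes p with P? x
  ... | yes _ = refl
  ... | no ¬p = contradiction p ¬p

  count-no : ¬ P x → count P? (x ∷ s) ≡ count P? s
  count-no ¬p with P? x
  ... | yes p = contradiction p ¬p
  ... | no  _ = refl

ranks-∷ : {s : Vec (Fin n) k} {w x : Fin n} → x ≢ w →
          smaller x (w ∷ s) + larger x (w ∷ s) ≡ suc (smaller x s + larger x s)
ranks-∷ {s = s} {w} {x} x≢w with Fin.<-cmp x w
... | tri< x<w _ w≮x = trans
  (cong₂ _+_ (count-no (Fin._<? x) {s} w≮x) (count-yes (x Fin.<?_) {s} x<w)) (ℕ.+-suc _ _)
... | tri≈ _ x≡w _   = contradiction x≡w x≢w
... | tri> x≮w _ w<x =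
  cong₂ _+_ (count-yes (Fin._<? x) {s} w<x) (count-no (x Fin.<?_) {s} x≮w)

absent-ranks : {s : Vec (Fin n) k} {x : Fin n} → All (x ≢_) s → smaller x s + larger x s ≡ k
absent-ranks [] = refl
absent-ranks {s = _ ∷ s} (x≢w ∷ x∉s) = trans (ranks-∷ {s = s} x≢w) (cong suc (absent-ranks x∉s))

ranks : {s : Vec (Fin n) k} {x : Fin n} → Unique s → x ∈ s → suc (smaller x s + larger x s) ≡ k
ranks {s = w ∷ s} (w∉s ∷ u) (here refl) = cong suc (trans
  (cong₂ _+_ (count-no (Fin._<? w) {s} (Fin.<-irrefl refl)) (count-no (w Fin.<?_) {s} (Fin.<-irrefl refl)))
  (absent-ranks w∉s))
ranks {s = _ ∷ s} (w∉s ∷ u) (there x∈s) =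
  cong suc (trans (ranks-∷ {s = s} (All.lookup w∉s x∈s ∘ sym)) (ranks u x∈s))

larger<length : {s : Vec (Fin n) k} {x : Fin n} → Unique s → x ∈ s → larger x s < k
larger<length {s = s} {x} u x∈s =
  subst (larger x s <_) (ranks u x∈s) (ℕ.s≤s (ℕ.m≤n+m (larger x s) (smaller x s)))

smaller<length : {s : Vec (Fin n) k} {x : Fin n} → Unique s → x ∈ s → smaller x s < k
smaller<length {s = s} {x} u x∈s =
  subst (smaller x s <_) (ranks u x∈s) (ℕ.s≤s (ℕ.m≤m+n (smaller x s) (larger x s)))

injective⇒hits : (f : Fin k → Fin k) → Injective _≡_ _≡_ f → ∀ j → ∃[ i ] f i ≡ j
injective⇒hits {suc k} f inj j with Fin.any? (λ i → f i Fin.≟ j)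
... | yes hit = hit
... | no miss = contradiction
  (Fin.injective⇒≤ {f = λ i → Fin.punchOut (λ j≡fi → miss (i , sym j≡fi))}
    (λ {a} {b} eq → inj (Fin.punchOut-injective (λ e → miss (a , sym e)) (λ e → miss (b , sym e)) eq)))
  ℕ.1+n≰n

find-spec : {A : Set} {P : Pred A 0ℓ} (P? : Decidable P) (d : A) {y : A} {l : List A} →
            y ∈ₗ l → P y →
            let r = fromMaybe d (List.find P? l) in r ∈ₗ l × P r
find-spec P? d {l = x ∷ l} y∈ Py with P? x | y∈
... | yes Px | _         = here refl , Px
... | no ¬Px | here refl = contradiction Py ¬Px
... | no ¬Px | there y∈l with r∈ , Pr ← find-spec P? d y∈l Py = there r∈ , Pr

opposite-spec : {s : Vec (Fin n) k} {x : Fin n} → Unique s → x ∈ s →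
                opposite s x ∈ s × larger (opposite s x) s ≡ smaller x s
opposite-spec {n} {k} {s} {x} u x∈s = Vec.∈-toList⁻ (proj₁ found) , proj₂ found
  where
  rank : Fin k → Fin k
  rank i = fromℕ< (larger<length u (Vec.∈-lookup i s))
  rank-injective : Injective _≡_ _≡_ rank
  rank-injective {i} {j} eq = Unique.lookup-injective u i j
    (larger-injective (Vec.∈-lookup i s) (Vec.∈-lookup j s)
      (Fin.fromℕ<-injective _ _ (larger<length u (Vec.∈-lookup i s)) (larger<length u (Vec.∈-lookup j s)) eq))
  hit : ∃[ i ] rank i ≡ fromℕ< (smaller<length u x∈s)
  hit = injective⇒hits rank rank-injective (fromℕ< (smaller<length u x∈s))
  eqn : larger (Vec.lookup s (proj₁ hit)) s ≡ smaller x s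
  eqn = Fin.fromℕ<-injective _ _ (larger<length u (Vec.∈-lookup (proj₁ hit) s)) (smaller<length u x∈s) (proj₂ hit)
  found = find-spec (λ y → larger y s ℕ.≟ smaller x s) x (Vec.∈-toList⁺ (Vec.∈-lookup (proj₁ hit) s)) eqn

opposite-∈ : {s : Vec (Fin n) k} {x : Fin n} → Unique s → x ∈ s → opposite s x ∈ s
opposite-∈ u x∈s = proj₁ (opposite-spec u x∈s)

opposite-rank : {s : Vec (Fin n) k} {x : Fin n} (u : Unique s) (x∈s : x ∈ s) →
                larger (opposite s x) s ≡ smaller x s
opposite-rank u x∈s = proj₂ (opposite-spec u x∈s)

opposite-unique : {s : Vec (Fin n) k} {x y : Fin n} → Unique s → x ∈ s → y ∈ s →
                  larger y s ≡ smaller x s → opposite s x ≡ y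
opposite-unique u x∈s y∈s eq =
  larger-injective (opposite-∈ u x∈s) y∈s (trans (opposite-rank u x∈s) (sym eq))

ranks-swap : {s : Vec (Fin n) k} {x y : Fin n} → Unique s → x ∈ s → y ∈ s →
             larger y s ≡ smaller x s → smaller y s ≡ larger x s
ranks-swap {s = s} {x} {y} u x∈s y∈s eq = ℕ.+-cancelʳ-≡ (larger y s) _ _ (ℕ.suc-injective (begin
  suc (smaller y s + larger y s) ≡⟨ ranks u y∈s ⟩
  _                              ≡⟨ ranks u x∈s ⟨
  suc (smaller x s + larger x s) ≡⟨ cong suc (ℕ.+-comm (smaller x s) _) ⟩
  suc (larger x s + smaller x s) ≡⟨ cong (λ h → suc (larger x s + h)) eq ⟨
  suc (larger x s + larger y s)  ∎))
  where open ≡-Reasoning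

opposite-involutive : {s : Vec (Fin n) k} {x : Fin n} → Unique s → x ∈ s →
                      opposite s (opposite s x) ≡ x
opposite-involutive u x∈s =
  opposite-unique u (opposite-∈ u x∈s) x∈s
    (sym (ranks-swap u x∈s (opposite-∈ u x∈s) (opposite-rank u x∈s)))

Reverses : (Fin n → Fin n) → Vec (Fin n) k → Set
Reverses f s = ∀ {x y} → x ∈ s → y ∈ s → x Fin.< y → f y Fin.< f x

opposite-reverses : {s : Vec (Fin n) k} → Unique s → Reverses (opposite s) s
opposite-reverses u x∈s y∈s x<y =
  larger-reflects-< (opposite-∈ u y∈s) (opposite-∈ u x∈s)
    (subst₂ _<_ (sym (opposite-rank u x∈s)) (sym (opposite-rank u y∈s)) (smaller-< x∈s x<y))

module _ {f : Fin n → Fin n} {s : Vec (Fin n) k} (rev : Reverses f s) where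

  reverses-injective : ∀ {x y} → x ∈ s → y ∈ s → f x ≡ f y → x ≡ y
  reverses-injective {x} {y} x∈s y∈s eq with Fin.<-cmp x y
  ... | tri< x<y _ _ = contradiction (rev x∈s y∈s x<y) (Fin.<-irrefl (sym eq))
  ... | tri≈ _ x≡y _ = x≡y
  ... | tri> _ _ y<x = contradiction (rev y∈s x∈s y<x) (Fin.<-irrefl eq)

  reverses-reflects : ∀ {x y} → x ∈ s → y ∈ s → f x Fin.< f y → y Fin.< x
  reverses-reflects {x} {y} x∈s y∈s lt with Fin.<-cmp x y
  ... | tri< x<y _ _  = contradiction lt (Fin.<-asym (rev x∈s y∈s x<y))
  ... | tri≈ _ refl _ = contradiction lt (Fin.<-irrefl refl)
  ... | tri> _ _ y<x  = y<x

  larger-map : ∀ {x} → x ∈ s → larger (f x) (Vec.map f s) ≡ smaller x s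
  larger-map {x} x∈s = trans (count-map (f x Fin.<?_) f s)
    (count-cong _ (Fin._<? x) (λ w∈s → reverses-reflects x∈s w∈s) (λ w∈s → rev w∈s x∈s))

  smaller-map : ∀ {x} → x ∈ s → smaller (f x) (Vec.map f s) ≡ larger x s
  smaller-map {x} x∈s = trans (count-map (Fin._<? f x) f s)
    (count-cong _ (x Fin.<?_) (λ w∈s → reverses-reflects w∈s x∈s) (λ w∈s → rev x∈s w∈s))

map-unique : {f : Fin n → Fin n} {s : Vec (Fin n) k} →
             (∀ {x y} → x ∈ s → y ∈ s → f x ≡ f y → x ≡ y) → Unique s → Unique (Vec.map f s)
map-unique {s = []} inj [] = []
map-unique {f = f} {s = x ∷ s} inj (x∉s ∷ u) =
  distinct x∉s (λ y∈s → inj (here refl) (there y∈s)) ∷ map-unique (λ a b → inj (there a) (there b)) u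
  where
  distinct : ∀ {j} {t : Vec _ j} → All (x ≢_) t → (∀ {y} → y ∈ t → f x ≡ f y → x ≡ y) →
             All (f x ≢_) (Vec.map f t)
  distinct []         _ = []
  distinct (x≢y ∷ ps) g = (x≢y ∘ g (here refl)) ∷ distinct ps (g ∘ there)

map-cong-∈ : {f g : Fin n → Fin n} {s : Vec (Fin n) k} →
             (∀ {x} → x ∈ s → f x ≡ g x) → Vec.map f s ≡ Vec.map g s
map-cong-∈ {s = []}    eq = refl
map-cong-∈ {s = x ∷ s} eq = cong₂ _∷_ (eq (here refl)) (map-cong-∈ (eq ∘ there))

∈-map⁻ᵥ : {f : Fin n → Fin n} {s : Vec (Fin n) k} {y : Fin n} →
          y ∈ Vec.map f s → ∃[ x ] x ∈ s × y ≡ f x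
∈-map⁻ᵥ {s = x ∷ s} (here eq) = x , here refl , eq
∈-map⁻ᵥ {s = x ∷ s} (there y∈) with w , w∈s , eq ← ∈-map⁻ᵥ y∈ = w , there w∈s , eq

opposite-map : {f : Fin n → Fin n} {s : Vec (Fin n) k} → Unique s → Reverses f s →
               ∀ {x} → x ∈ s → opposite (Vec.map f s) (f x) ≡ f (opposite s x)
opposite-map {f = f} {s} u rev {x} x∈s =
  opposite-unique (map-unique (reverses-injective rev) u) (Vec.∈-map⁺ f x∈s) (Vec.∈-map⁺ f o∈s) (begin
    larger (f (opposite s x)) (Vec.map f s) ≡⟨ larger-map rev o∈s ⟩
    smaller (opposite s x) s                ≡⟨ ranks-swap u x∈s o∈s (opposite-rank u x∈s) ⟩
    larger x s                              ≡⟨ smaller-map rev x∈s ⟨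
    smaller (f x) (Vec.map f s)             ∎)
  where
  open ≡-Reasoning
  o∈s = opposite-∈ u x∈s

map-∘ : {f g : Fin n → Fin n} (s : Vec (Fin n) k) → Vec.map f (Vec.map g s) ≡ Vec.map (f ∘ g) s
map-∘ []      = refl
map-∘ (x ∷ s) = cong (_ ∷_) (map-∘ s)

map-id : (s : Vec (Fin n) k) → Vec.map id s ≡ s
map-id []      = refl
map-id (x ∷ s) = cong (x ∷_) (map-id s)

complement-map : {f : Fin n → Fin n} {s : Vec (Fin n) k} → Unique s → Reverses f s →
                 complement (Vec.map f s) ≡ Vec.map f (complement s)
complement-map {f = f} {s} u rev = begin
  complement (Vec.map f s)                  ≡⟨ map-∘ s ⟩
  Vec.map (opposite (Vec.map f s) ∘ f) s    ≡⟨ map-cong-∈ (opposite-map u rev) ⟩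
  Vec.map (f ∘ opposite s) s                ≡⟨ map-∘ s ⟨
  Vec.map f (complement s)                  ∎
  where open ≡-Reasoning

complementAfter-∈ : ∀ j {s : Vec (Fin n) k} {x : Fin n} → Unique s → x ∈ complementAfter j s → x ∈ s
complementAfter-∈ zero u x∈ with w , w∈s , refl ← ∈-map⁻ᵥ x∈ = opposite-∈ u w∈s
complementAfter-∈ (suc j) {s = _ ∷ _} _ (here eq) = here eq
complementAfter-∈ (suc j) {s = _ ∷ _} (_ ∷ u) (there x∈) = there (complementAfter-∈ j u x∈)

all-from : {A : Set} {P : Pred A 0ℓ} {s : Vec A k} → (∀ {x} → x ∈ s → P x) → All P s
all-from {s = []}    f = []
all-from {s = x ∷ s} f = f (here refl) ∷ all-from (f ∘ there)

complementAfter-unique : ∀ j {s : Vec (Fin n) k} → Unique s → Unique (complementAfter j s)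
complementAfter-unique zero u = map-unique (reverses-injective (opposite-reverses u)) u
complementAfter-unique (suc j) {[]} u = u
complementAfter-unique (suc j) {x ∷ s} (x∉s ∷ u) =
  all-from (λ y∈ → All.lookup x∉s (complementAfter-∈ j u y∈)) ∷ complementAfter-unique j u

complementAfter-involutive : ∀ j {s : Vec (Fin n) k} → Unique s →
                             complementAfter j (complementAfter j s) ≡ s
complementAfter-involutive zero {s} u = begin
  complement (complement s)               ≡⟨ complement-map u (opposite-reverses u) ⟩
  Vec.map (opposite s) (complement s)     ≡⟨ map-∘ s ⟩
  Vec.map (opposite s ∘ opposite s) s     ≡⟨ map-cong-∈ (opposite-involutive u) ⟩
  Vec.map id s                            ≡⟨ map-id s ⟩
  s                                       ∎
  where open ≡-Reasoning
complementAfter-involutive (suc j) {[]} u = refl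
complementAfter-involutive (suc j) {x ∷ s} (_ ∷ u) = cong (x ∷_) (complementAfter-involutive j u)

complementAfter-map : ∀ j {f : Fin n → Fin n} {s : Vec (Fin n) k} → Unique s → Reverses f s →
                      complementAfter j (Vec.map f s) ≡ Vec.map f (complementAfter j s)
complementAfter-map zero u rev = complement-map u rev
complementAfter-map (suc j) {s = []} u rev = refl
complementAfter-map (suc j) {s = x ∷ s} (_ ∷ u) rev =
  cong (_ ∷_) (complementAfter-map j u (λ a b → rev (there a) (there b)))

opposite-complementAfter : ∀ j {s : Vec (Fin n) k} {x : Fin n} → Unique s → x ∈ complementAfter j s →
                           opposite (complementAfter j s) x ≡ opposite s x
opposite-complementAfter j {s} {x} u x∈ =
  sym (opposite-unique u (sub x∈) (sub (opposite-∈ u′ x∈))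
    (trans (sym (same (_ Fin.<?_))) (trans (opposite-rank u′ x∈) (same (Fin._<? x)))))
  where
  u′ = complementAfter-unique j u
  sub : ∀ {y} → y ∈ complementAfter j s → y ∈ s
  sub = complementAfter-∈ j u
  same : ∀ {P : Pred _ 0ℓ} (P? : Decidable P) → count P? (complementAfter j s) ≡ count P? s
  same = count-⊆ u′ sub

complement-commutes : ∀ j {s : Vec (Fin n) k} → Unique s →
                      complement (complementAfter j s) ≡ complementAfter j (complement s)
complement-commutes j u = trans (map-cong-∈ (opposite-complementAfter j u))
                                (sym (complementAfter-map j u (opposite-reverses u)))

complementAfter-commutes : ∀ i j {s : Vec (Fin n) k} → Unique s →
  complementAfter i (complementAfter j s) ≡ complementAfter j (complementAfter i s)
complementAfter-commutes zero    j       u = complement-commutes j u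
complementAfter-commutes (suc i) zero    u = sym (complement-commutes (suc i) u)
complementAfter-commutes (suc i) (suc j) {[]} u = refl
complementAfter-commutes (suc i) (suc j) {x ∷ s} (_ ∷ u) = cong (x ∷_) (complementAfter-commutes i j u)

-- One-line notation, with the values 1, …, n shifted to 0, …, n - 1.

record Perm (n : ℕ) : Set where
  constructor perm
  field
    word      : Vec (Fin n) n
    .distinct : Unique word

open Perm public using (word)

words : ∀ n k → List (Vec (Fin n) k)
words n zero    = [] ∷ []
words n (suc k) = List.cartesianProductWith _∷_ (List.allFin n) (words n k)

toPerm : Vec (Fin n) n → Maybe (Perm n)
toPerm w with unique? w
... | yes u = just (perm w u)
... | no  _ = nothing

perms : ∀ n → List (Perm n)
perms n = List.mapMaybe toPerm (words n n)

ChangesDirection : Fin n → Fin n → Fin n → Set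
ChangesDirection a b c = (a Fin.< b × c Fin.< b) ⊎ (b Fin.< a × b Fin.< c)

changesDirection? : (a b c : Fin n) → Dec (ChangesDirection a b c)
changesDirection? a b c =
  ((a Fin.<? b) ×-dec (c Fin.<? b)) ⊎-dec ((b Fin.<? a) ×-dec (b Fin.<? c))

changes : Vec (Fin n) k → ℕ
changes (a ∷ s@(b ∷ c ∷ _)) =
  if does (changesDirection? a b c) then suc (changes s) else changes s
changes _ = 0

run : Perm n → ℕ
run p = suc (changes (word p))

R : ℕ → Poly
R n = ∑ (perms n) (λ p → z ^ run p)
  where open Polynomial

-- c i is meant for 1 ≤ i ≤ n: it fixes the first i ∸ 1 entries.

c : ℕ → Perm n → Perm n
c i (perm w u) = perm (complementAfter (i ∸ 1) w) (complementAfter-unique (i ∸ 1) u)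

data _∈𝒞_ (i n : ℕ) : Set where
  even : 2 ∣ n   → 3 ≤ i → ¬ 2 ∣ i → i ≤ n ∸ 1 → i ∈𝒞 n
  odd  : ¬ 2 ∣ n → 3 ≤ i → ¬ 2 ∣ i → i ≤ n ∸ 2 → i ∈𝒞 n

-- The subgroup of the symmetric group on Perm n generated by 𝒞.

data G (n : ℕ) : (Perm n → Perm n) → Set where
  generator : ∀ {i} → i ∈𝒞 n → G n (c i)
  identity  : G n id
  compose   : ∀ {f g} → G n f → G n g → G n (f ∘ g)
  inverse   : ∀ {f g} → G n f → Inverseᵇ _≡_ _≡_ f g → G n g

_∈Orbit_ : Perm n → Perm n → Set
r ∈Orbit q = ∃[ f ] G _ f × f q ≡ r

Minimal : Perm n → Set
Minimal q = ∀ r → r ∈Orbit q → run q ≤ run r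

perm-≡ : {p q : Perm n} → word p ≡ word q → p ≡ q
perm-≡ refl = refl

isUnique : (p : Perm n) → Unique (word p)
isUnique (perm w u) = recompute (unique? w) u

c-involutive : ∀ i (p : Perm n) → c i (c i p) ≡ p
c-involutive i p = perm-≡ (complementAfter-involutive (i ∸ 1) (isUnique p))

c-commutes : ∀ i j (p : Perm n) → c i (c j p) ≡ c j (c i p)
c-commutes i j p = perm-≡ (complementAfter-commutes (i ∸ 1) (j ∸ 1) (isUnique p))

_∈𝒞?_ : ∀ i n → Dec (i ∈𝒞 n)
i ∈𝒞? n = map′
  (λ { (inj₁ (a , b , d , e)) → even a b d e ; (inj₂ (a , b , d , e)) → odd a b d e })
  (λ { (even a b d e) → inj₁ (a , b , d , e) ; (odd a b d e) → inj₂ (a , b , d , e) })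
  ((2 ∣? n ×-dec 3 ℕ.≤? i ×-dec ¬? (2 ∣? i) ×-dec i ℕ.≤? n ∸ 1)
    ⊎-dec
   (¬? (2 ∣? n) ×-dec 3 ℕ.≤? i ×-dec ¬? (2 ∣? i) ×-dec i ℕ.≤? n ∸ 2))

∈𝒞⇒≤ : ∀ {i} → i ∈𝒞 n → i ≤ n
∈𝒞⇒≤ {n} (even _ _ _ i≤) = ℕ.≤-trans i≤ (ℕ.m∸n≤m n 1)
∈𝒞⇒≤ {n} (odd  _ _ _ i≤) = ℕ.≤-trans i≤ (ℕ.m∸n≤m n 2)

indices : ℕ → List ℕ
indices n = List.filter (_∈𝒞? n) (List.upTo (suc n))

translates : List ℕ → Perm n → List (Perm n)
translates []       q = q ∷ []
translates (i ∷ is) q = translates is q ++ List.map (c i) (translates is q)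

base∈translates : ∀ is (q : Perm n) → q ∈ₗ translates is q
base∈translates []       q = here refl
base∈translates (i ∷ is) q = ∈-++⁺ˡ (base∈translates is q)

translates-closed : ∀ is {i} {q r : Perm n} → i ∈ₗ is → r ∈ₗ translates is q → c i r ∈ₗ translates is q
translates-closed (j ∷ is) {i} {q} i∈ r∈ with i∈ | ∈-++⁻ (translates is q) r∈
... | here refl | inj₁ r∈′ = ∈-++⁺ʳ (translates is q) (∈-map⁺ (c j) r∈′)
... | here refl | inj₂ r∈′ with s , s∈ , refl ← ∈-map⁻ (c j) r∈′ =
  ∈-++⁺ˡ (subst (_∈ₗ translates is q) (sym (c-involutive j s)) s∈)
... | there i∈is | inj₁ r∈′ = ∈-++⁺ˡ (translates-closed is i∈is r∈′)
... | there i∈is | inj₂ r∈′ with s , s∈ , refl ← ∈-map⁻ (c j) r∈′ =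
  ∈-++⁺ʳ (translates is q)
    (subst (_∈ₗ List.map (c j) (translates is q)) (sym (c-commutes i j s))
      (∈-map⁺ (c j) (translates-closed is i∈is s∈)))

translates⊆orbit : ∀ is {q r : Perm n} → (∀ {i} → i ∈ₗ is → i ∈𝒞 n) →
                   r ∈ₗ translates is q → r ∈Orbit q
translates⊆orbit [] _ (here refl) = id , identity , refl
translates⊆orbit (i ∷ is) {q} is⊆𝒞 r∈ with ∈-++⁻ (translates is q) r∈
... | inj₁ r∈′ = translates⊆orbit is (is⊆𝒞 ∘ there) r∈′
... | inj₂ r∈′ with s , s∈ , refl ← ∈-map⁻ (c i) r∈′
               with f , f∈G , refl ← translates⊆orbit is (is⊆𝒞 ∘ there) s∈ =
  c i ∘ f , compose (generator (is⊆𝒞 (here refl))) f∈G , refl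

orbit : Perm n → List (Perm n)
orbit {n} = translates (indices n)

-- Closure of the finite orbits under f in both directions, so that the
-- inverse rule of G goes through.

orbit-closed : ∀ {f} → G n f → (q r : Perm n) →
               (r ∈ₗ orbit q → f r ∈ₗ orbit q) × (f r ∈ₗ orbit q → r ∈ₗ orbit q)
orbit-closed {n} (generator {i} i∈) q r =
  closed , subst (_∈ₗ orbit q) (c-involutive i r) ∘ closed
  where
  closed : ∀ {s} → s ∈ₗ orbit q → c i s ∈ₗ orbit q
  closed = translates-closed (indices n) (∈-filter⁺ (_∈𝒞? n) (∈-upTo⁺ (ℕ.s≤s (∈𝒞⇒≤ i∈))) i∈)
orbit-closed identity q r = id , id
orbit-closed (compose {f} {g} f∈ g∈) q r =
    proj₁ (orbit-closed f∈ q (g r)) ∘ proj₁ (orbit-closed g∈ q r)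
  , proj₂ (orbit-closed g∈ q r) ∘ proj₂ (orbit-closed f∈ q (g r))
orbit-closed (inverse {f} {g} f∈ (f∘g , _)) q r =
    proj₂ (orbit-closed f∈ q (g r)) ∘ subst (_∈ₗ orbit q) (sym (f∘g refl))
  , subst (_∈ₗ orbit q) (f∘g refl) ∘ proj₁ (orbit-closed f∈ q (g r))

orbit-sound : {q r : Perm n} → r ∈ₗ orbit q → r ∈Orbit q
orbit-sound {n} = translates⊆orbit (indices n) (λ i∈ → proj₂ (∈-filter⁻ (_∈𝒞? n) i∈))

orbit-complete : {q r : Perm n} → r ∈Orbit q → r ∈ₗ orbit q
orbit-complete {n} {q} (f , f∈G , refl) = proj₁ (orbit-closed f∈G q q) (base∈translates (indices n) q)

minimal? : Decidable (Minimal {n})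
minimal? q = map′
  (λ all r r∈ → ListAll.lookup all (orbit-complete r∈))
  (λ min → ListAll.tabulate (λ r∈ → min _ (orbit-sound r∈)))
  (ListAll.all? (λ r → run q ℕ.≤? run r) (orbit q))

{-# OPTIONS --safe #-}

-- Only the changes of direction at i - 1 and i are affected by c_i: the
-- step p_{i-2} p_{i-1} is kept, the step p_i p_{i+1} is reversed, and the
-- step between them is kept or reversed; in both cases the number of
-- alternating runs changes by exactly one.  For j ≠ i in the same parity
-- class, c_j either fixes p_{i-2} ⋯ p_{i+1} and the set {p_i, …, p_n}, or
-- reverses all comparisons in p_{i-2} ⋯ p_n, so it does not affect whether
-- c_i raises or lowers the number of runs.  Pairing p with c_i(p) for one i
-- after the other therefore splits off one factor 1 + z each time, and the
-- permutations that remain, those for which every c_i raises the number of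
-- runs, are exactly the minimal ones.

module Submission where

open import Algebra.Bundles using (CommutativeMonoid; CommutativeSemiring)
import Algebra.Consequences.Setoid as Consequences
open import Algebra.Definitions.RawMagma using (_,_)
import Algebra.Properties.CommutativeSemigroup as CommutativeSemigroupProperties
open import Algebra.Structures using (IsCommutativeMonoid; IsCommutativeSemiring)
open import Algebra.Structures.Biased using (isCommutativeSemiringˡ)
open import Data.Bool using (Bool; true; false; not; _∧_; _∨_; _xor_; if_then_else_)
open import Data.Bool.Properties using (∨-comm)
open import Data.Fin as Fin using (Fin)
import Data.Fin.Properties as Fin
open import Data.Integer as ℤ using (ℤ)
import Data.Integer.Properties as ℤ
open import Data.List as List using (List; []; _∷_; filter; length; applyUpTo)
open import Data.List.Membership.Propositional using () renaming (_∈_ to _∈ₗ_)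
open import Data.List.Membership.Propositional.Properties using (∈-++⁻; ∈-map⁺; ∈-map⁻; ∈-filter⁺; ∈-filter⁻; ∈-allFin; ∈-cartesianProductWith⁺; ∈-applyUpTo⁺)
open import Data.List.Membership.Propositional.Properties.WithK using (unique∧set⇒bag)
open import Data.List.Properties using (length-applyUpTo) renaming (map-∘ to mapₗ-∘)
open import Data.List.Relation.Binary.BagAndSetEquality using (∼bag⇒↭)
open import Data.List.Relation.Binary.Permutation.Propositional using (_↭_; refl; prep; swap; trans)
open import Data.List.Relation.Unary.All as Allₗ using ([]; _∷_) renaming (All to Allₗ)
import Data.List.Relation.Unary.All.Properties as Allₗ
open import Data.List.Relation.Unary.AllPairs using ([]; _∷_)
open import Data.List.Relation.Unary.Any using (here; there)
open import Data.List.Relation.Unary.Unique.Propositional using () renaming (Unique to Uniqueₗ)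
import Data.List.Relation.Unary.Unique.Propositional.Properties as Uniqueₗ
open import Data.Nat as ℕ using (ℕ; zero; suc; _≤_; _<_; _<?_; _∸_; _/_; z≤n; s≤s; s<s; s<s⁻¹)
open import Data.Nat.Divisibility using (divides; _∣?_) renaming (_∣_ to _∣ₙ_)
open import Data.Nat.DivMod using (m/n*n≤m; /-monoˡ-≤; m*n/n≡m)
import Data.Nat.Properties as ℕ
open import Data.Product using (∃-syntax; _×_; _,_; proj₁; proj₂)
open import Data.Sum as Sum using (_⊎_; inj₁; inj₂)
open import Data.Vec as Vec using (Vec; []; _∷_)
open import Data.Vec.Membership.Propositional using (_∈_)
import Data.Vec.Properties as Vec
open import Data.Vec.Relation.Unary.All using ([]; _∷_)
open import Data.Vec.Relation.Unary.Any using (here; there)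
open import Data.Vec.Relation.Unary.Unique.Propositional using (Unique; []; _∷_)
open import Function using (_∘_; _⇔_; mk⇔)
open import Function.Bundles using (module Equivalence)
open import Level using (0ℓ)
open import Relation.Binary.Bundles using (Setoid)
open import Relation.Binary.Definitions using (tri<; tri≈; tri>)
open import Relation.Binary.PropositionalEquality as ≡ using (_≡_; _≢_; refl; cong; cong₂; sym; subst; subst₂; module ≡-Reasoning)
import Relation.Binary.Reasoning.Setoid as SetoidReasoning
open import Relation.Nullary using (¬_; yes; no; ¬?; does; contradiction)
open import Relation.Nullary.Decidable using (does-⇔; dec-true; dec-false)
open import Relation.Unary using (Pred; Decidable)
open import Defs
open Polynomial

private
  variable
    n k : ℕ
    A B : Set

-- Integer polynomials as a commutative semiring

infixr 8 _•_

_•_ : ℤ → Poly → Poly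
a • f = List.map (a ℤ.*_) f

coeff-+ : ∀ f g k → coeff (f +ₚ g) k ≡ coeff f k ℤ.+ coeff g k
coeff-+ []      g       k       = sym (ℤ.+-identityˡ _)
coeff-+ (a ∷ f) []      k       = sym (ℤ.+-identityʳ _)
coeff-+ (a ∷ f) (b ∷ g) zero    = refl
coeff-+ (a ∷ f) (b ∷ g) (suc k) = coeff-+ f g k

coeff-• : ∀ a f k → coeff (a • f) k ≡ a ℤ.* coeff f k
coeff-• a []      k       = sym (ℤ.*-zeroʳ a)
coeff-• a (b ∷ f) zero    = refl
coeff-• a (b ∷ f) (suc k) = coeff-• a f k

-- _≈ₚ_ computes to a family of equations between coefficients, from which
-- the polynomials cannot be inferred; the record keeps them visible.

infix 4 _≋_

record _≋_ (f g : Poly) : Set where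
  constructor coeffwise
  field
    coeff-≡ : f ≈ₚ g

open _≋_

≋-setoid : Setoid 0ℓ 0ℓ
≋-setoid = record
  { Carrier       = Poly
  ; _≈_           = _≋_
  ; isEquivalence = record
    { refl  = coeffwise λ _ → refl
    ; sym   = λ f≋g → coeffwise λ k → sym (coeff-≡ f≋g k)
    ; trans = λ f≋g g≋h → coeffwise λ k → ≡.trans (coeff-≡ f≋g k) (coeff-≡ g≋h k)
    }
  }

module ≋ = Setoid ≋-setoid

∷-cong : ∀ {a b f g} → a ≡ b → f ≋ g → (a ∷ f) ≋ (b ∷ g)
∷-cong a≡b f≋g = coeffwise λ { zero → a≡b ; (suc k) → coeff-≡ f≋g k }

+ₚ-cong : ∀ {f g h i} → f ≋ g → h ≋ i → (f +ₚ h) ≋ (g +ₚ i)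
+ₚ-cong {f} {g} {h} {i} f≋g h≋i = coeffwise λ k → begin
  coeff (f +ₚ h) k          ≡⟨ coeff-+ f h k ⟩
  coeff f k ℤ.+ coeff h k   ≡⟨ cong₂ ℤ._+_ (coeff-≡ f≋g k) (coeff-≡ h≋i k) ⟩
  coeff g k ℤ.+ coeff i k   ≡⟨ coeff-+ g i k ⟨
  coeff (g +ₚ i) k          ∎
  where open ≡-Reasoning

+ₚ-congˡ : ∀ f {g h} → g ≋ h → (f +ₚ g) ≋ (f +ₚ h)
+ₚ-congˡ f g≋h = +ₚ-cong {f} ≋.refl g≋h

+ₚ-assoc : ∀ f g h → ((f +ₚ g) +ₚ h) ≋ (f +ₚ (g +ₚ h))
+ₚ-assoc []      g       h       = ≋.refl
+ₚ-assoc (a ∷ f) []      h       = ≋.refl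
+ₚ-assoc (a ∷ f) (b ∷ g) []      = ≋.refl
+ₚ-assoc (a ∷ f) (b ∷ g) (d ∷ h) = ∷-cong (ℤ.+-assoc a b d) (+ₚ-assoc f g h)

+ₚ-comm : ∀ f g → (f +ₚ g) ≋ (g +ₚ f)
+ₚ-comm f g = coeffwise λ k → begin
  coeff (f +ₚ g) k          ≡⟨ coeff-+ f g k ⟩
  coeff f k ℤ.+ coeff g k   ≡⟨ ℤ.+-comm (coeff f k) _ ⟩
  coeff g k ℤ.+ coeff f k   ≡⟨ coeff-+ g f k ⟨
  coeff (g +ₚ f) k          ∎
  where open ≡-Reasoning

+ₚ-identityʳ : ∀ f → (f +ₚ []) ≋ f
+ₚ-identityʳ []      = ≋.refl
+ₚ-identityʳ (a ∷ f) = ≋.refl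

+ₚ-isCommutativeMonoid : IsCommutativeMonoid _≋_ _+ₚ_ []
+ₚ-isCommutativeMonoid = record
  { isMonoid = record
    { isSemigroup = record
      { isMagma = record { isEquivalence = ≋.isEquivalence ; ∙-cong = +ₚ-cong }
      ; assoc   = +ₚ-assoc
      }
    ; identity = (λ _ → ≋.refl) , +ₚ-identityʳ
    }
  ; comm = +ₚ-comm
  }

+ₚ-commutativeMonoid : CommutativeMonoid 0ℓ 0ℓ
+ₚ-commutativeMonoid = record { isCommutativeMonoid = +ₚ-isCommutativeMonoid }

open CommutativeSemigroupProperties (CommutativeMonoid.commutativeSemigroup +ₚ-commutativeMonoid)
  using (interchange; x∙yz≈y∙xz)

•-cong : ∀ a {f g} → f ≋ g → (a • f) ≋ (a • g)
•-cong a {f} {g} f≋g = coeffwise λ k → begin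
  coeff (a • f) k   ≡⟨ coeff-• a f k ⟩
  a ℤ.* coeff f k   ≡⟨ cong (a ℤ.*_) (coeff-≡ f≋g k) ⟩
  a ℤ.* coeff g k   ≡⟨ coeff-• a g k ⟨
  coeff (a • g) k   ∎
  where open ≡-Reasoning

•-distribʳ : ∀ a b f → ((a ℤ.+ b) • f) ≋ ((a • f) +ₚ (b • f))
•-distribʳ a b []      = ≋.refl
•-distribʳ a b (d ∷ f) = ∷-cong (ℤ.*-distribʳ-+ d a b) (•-distribʳ a b f)

•-distribˡ : ∀ a f g → (a • (f +ₚ g)) ≋ ((a • f) +ₚ (a • g))
•-distribˡ a []      g       = ≋.refl
•-distribˡ a (b ∷ f) []      = ≋.refl
•-distribˡ a (b ∷ f) (d ∷ g) = ∷-cong (ℤ.*-distribˡ-+ a b d) (•-distribˡ a f g)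

•-assoc : ∀ a b f → ((a ℤ.* b) • f) ≋ (a • b • f)
•-assoc a b []      = ≋.refl
•-assoc a b (d ∷ f) = ∷-cong (ℤ.*-assoc a b d) (•-assoc a b f)

0∷[]≋[] : (ℤ.0ℤ ∷ []) ≋ []
0∷[]≋[] = coeffwise λ { zero → refl ; (suc k) → refl }

0•f≋0 : ∀ f → (ℤ.0ℤ • f) ≋ []
0•f≋0 []      = ≋.refl
0•f≋0 (a ∷ f) = ≋.trans (∷-cong refl (0•f≋0 f)) 0∷[]≋[]

1•f≋f : ∀ f → (ℤ.1ℤ • f) ≋ f
1•f≋f []      = ≋.refl
1•f≋f (a ∷ f) = ∷-cong (ℤ.*-identityˡ a) (1•f≋f f)

*ₚ-zeroʳ : ∀ f → (f *ₚ []) ≋ []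
*ₚ-zeroʳ []      = ≋.refl
*ₚ-zeroʳ (a ∷ f) = ≋.trans (∷-cong refl (*ₚ-zeroʳ f)) 0∷[]≋[]

-- Multiplication is defined by recursion on the left factor; this is the mirrored recursion on the
-- right factor, from which commutativity follows by induction.
*ₚ-∷ : ∀ f b g → (f *ₚ (b ∷ g)) ≋ ((b • f) +ₚ (ℤ.0ℤ ∷ (f *ₚ g)))
*ₚ-∷ []      b g = ≋.sym 0∷[]≋[]
*ₚ-∷ (a ∷ f) b g = ∷-cong (cong (ℤ._+ ℤ.0ℤ) (ℤ.*-comm a b)) (begin
  (a • g) +ₚ (f *ₚ (b ∷ g))                       ≈⟨ +ₚ-congˡ (a • g) (*ₚ-∷ f b g) ⟩
  (a • g) +ₚ ((b • f) +ₚ (ℤ.0ℤ ∷ (f *ₚ g)))       ≈⟨ x∙yz≈y∙xz (a • g) (b • f) _ ⟩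
  (b • f) +ₚ ((a • g) +ₚ (ℤ.0ℤ ∷ (f *ₚ g)))       ∎)
  where open SetoidReasoning ≋-setoid

*ₚ-comm : ∀ f g → (f *ₚ g) ≋ (g *ₚ f)
*ₚ-comm []      g = ≋.sym (*ₚ-zeroʳ g)
*ₚ-comm (a ∷ f) g = ≋.trans (+ₚ-congˡ (a • g) (∷-cong refl (*ₚ-comm f g))) (≋.sym (*ₚ-∷ g a f))

*ₚ-congˡ : ∀ f {g h} → g ≋ h → (f *ₚ g) ≋ (f *ₚ h)
*ₚ-congˡ []      g≋h = ≋.refl
*ₚ-congˡ (a ∷ f) g≋h = +ₚ-cong (•-cong a g≋h) (∷-cong refl (*ₚ-congˡ f g≋h))

-- Equal left factors may be lists of different lengths, so they are not compared recursively:
-- commutativity moves them to the right, where `*ₚ-congˡ` applies.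
*ₚ-cong : ∀ {f g h i} → f ≋ g → h ≋ i → (f *ₚ h) ≋ (g *ₚ i)
*ₚ-cong {f} {g} {h} {i} f≋g h≋i = begin
  f *ₚ h   ≈⟨ *ₚ-congˡ f h≋i ⟩
  f *ₚ i   ≈⟨ *ₚ-comm f i ⟩
  i *ₚ f   ≈⟨ *ₚ-congˡ i f≋g ⟩
  i *ₚ g   ≈⟨ *ₚ-comm i g ⟩
  g *ₚ i   ∎
  where open SetoidReasoning ≋-setoid

*ₚ-distribʳ : ∀ h f g → ((f +ₚ g) *ₚ h) ≋ ((f *ₚ h) +ₚ (g *ₚ h))
*ₚ-distribʳ h []      g       = ≋.refl
*ₚ-distribʳ h (a ∷ f) []      = ≋.sym (+ₚ-identityʳ _)
*ₚ-distribʳ h (a ∷ f) (b ∷ g) = begin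
  ((a ℤ.+ b) • h) +ₚ (ℤ.0ℤ ∷ ((f +ₚ g) *ₚ h))
    ≈⟨ +ₚ-cong (•-distribʳ a b h) (∷-cong refl (*ₚ-distribʳ h f g)) ⟩
  ((a • h) +ₚ (b • h)) +ₚ ((ℤ.0ℤ ∷ (f *ₚ h)) +ₚ (ℤ.0ℤ ∷ (g *ₚ h)))
    ≈⟨ interchange (a • h) (b • h) _ _ ⟩
  ((a ∷ f) *ₚ h) +ₚ ((b ∷ g) *ₚ h) ∎
  where open SetoidReasoning ≋-setoid

•-*ₚ-assoc : ∀ a f g → ((a • f) *ₚ g) ≋ (a • (f *ₚ g))
•-*ₚ-assoc a []      g = ≋.refl
•-*ₚ-assoc a (b ∷ f) g = begin
  ((a ℤ.* b) • g) +ₚ (ℤ.0ℤ ∷ ((a • f) *ₚ g))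
    ≈⟨ +ₚ-cong (•-assoc a b g) (∷-cong (sym (ℤ.*-zeroʳ a)) (•-*ₚ-assoc a f g)) ⟩
  (a • b • g) +ₚ (a • (ℤ.0ℤ ∷ (f *ₚ g)))
    ≈⟨ •-distribˡ a (b • g) _ ⟨
  a • ((b ∷ f) *ₚ g) ∎
  where open SetoidReasoning ≋-setoid

*ₚ-assoc : ∀ f g h → ((f *ₚ g) *ₚ h) ≋ (f *ₚ (g *ₚ h))
*ₚ-assoc []      g h = ≋.refl
*ₚ-assoc (a ∷ f) g h = begin
  ((a • g) +ₚ (ℤ.0ℤ ∷ (f *ₚ g))) *ₚ h
    ≈⟨ *ₚ-distribʳ h (a • g) _ ⟩
  ((a • g) *ₚ h) +ₚ ((ℤ.0ℤ • h) +ₚ (ℤ.0ℤ ∷ ((f *ₚ g) *ₚ h)))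
    ≈⟨ +ₚ-cong (•-*ₚ-assoc a g h) (+ₚ-cong (0•f≋0 h) (∷-cong refl (*ₚ-assoc f g h))) ⟩
  (a ∷ f) *ₚ (g *ₚ h) ∎
  where open SetoidReasoning ≋-setoid

*ₚ-identityˡ : ∀ f → ((ℤ.1ℤ ∷ []) *ₚ f) ≋ f
*ₚ-identityˡ f = ≋.trans (+ₚ-cong (1•f≋f f) 0∷[]≋[]) (+ₚ-identityʳ f)

ℤ[z]-isCommutativeSemiring : IsCommutativeSemiring _≋_ _+ₚ_ _*ₚ_ [] (ℤ.1ℤ ∷ [])
ℤ[z]-isCommutativeSemiring = isCommutativeSemiringˡ record
  { +-isCommutativeMonoid = +ₚ-isCommutativeMonoid
  ; *-isCommutativeMonoid = record
    { isMonoid = record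
      { isSemigroup = record
        { isMagma = record { isEquivalence = ≋.isEquivalence ; ∙-cong = *ₚ-cong }
        ; assoc   = *ₚ-assoc
        }
      ; identity = Consequences.comm∧idˡ⇒id ≋-setoid *ₚ-comm *ₚ-identityˡ
      }
    ; comm = *ₚ-comm
    }
  ; distribʳ = *ₚ-distribʳ
  ; zeroˡ    = λ _ → ≋.refl
  }

ℤ[z]-commutativeSemiring : CommutativeSemiring 0ℓ 0ℓ
ℤ[z]-commutativeSemiring = record { isCommutativeSemiring = ℤ[z]-isCommutativeSemiring }

module ℤ[z] = CommutativeSemiring ℤ[z]-commutativeSemiring

-- Changes of direction under complementation of a suffix

up : Fin n → Fin n → Bool
up a b = does (a Fin.<? b)

up-flip : {a b : Fin n} → a ≢ b → up b a ≡ not (up a b)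
up-flip {a = a} {b} a≢b with Fin.<-cmp a b
... | tri< a<b _ b≮a = ≡.trans (dec-false (b Fin.<? a) b≮a) (cong not (sym (dec-true (a Fin.<? b) a<b)))
... | tri≈ _ a≡b _   = contradiction a≡b a≢b
... | tri> a≮b _ b<a = ≡.trans (dec-true (b Fin.<? a) b<a) (cong not (sym (dec-false (a Fin.<? b) a≮b)))

up-reverses : {f : Fin n → Fin n} {s : Vec (Fin n) k} → Reverses f s →
              ∀ {a b} → a ∈ s → b ∈ s → up (f a) (f b) ≡ up b a
up-reverses {f = f} rev {a} {b} a∈s b∈s =
  does-⇔ (mk⇔ (reverses-reflects rev a∈s b∈s) (rev b∈s a∈s)) (f a Fin.<? f b) (b Fin.<? a)

turn : Bool → Bool → ℕ
turn α β = if α xor β then 1 else 0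

-- Between distinct neighbours a step that does not go up goes down, so the two cases of
-- `ChangesDirection` merge into an exclusive or of consecutive directions.
changes-∷ : {a b d : Fin n} {s : Vec (Fin n) k} → a ≢ b → b ≢ d →
            changes (a ∷ b ∷ d ∷ s) ≡ turn (up a b) (up b d) ℕ.+ changes (b ∷ d ∷ s)
changes-∷ {a = a} {b} {d} {s} a≢b b≢d
  rewrite up-flip a≢b | up-flip b≢d = by-cases (up a b) (up b d)
  where
  m = changes (b ∷ d ∷ s)
  by-cases : ∀ α β → (if (α ∧ not β) ∨ (not α ∧ β) then suc m else m) ≡ turn α β ℕ.+ m
  by-cases true  true  = refl
  by-cases true  false = refl
  by-cases false true  = refl
  by-cases false false = refl

-- Reversing all comparisons exchanges peaks and valleys, that is, the two disjuncts of
-- `ChangesDirection`.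
changes-reverses : {f : Fin n → Fin n} {s : Vec (Fin n) k} → Reverses f s →
                   changes (Vec.map f s) ≡ changes s
changes-reverses {s = []}         rev = refl
changes-reverses {s = _ ∷ []}     rev = refl
changes-reverses {s = _ ∷ _ ∷ []} rev = refl
changes-reverses {f = f} {s = a ∷ s@(b ∷ d ∷ _)} rev =
  cong₂ (λ t m → if t then suc m else m) same-turn
    (changes-reverses {s = s} (λ x∈ y∈ → rev (there x∈) (there y∈)))
  where
  a∈ : a ∈ a ∷ s
  a∈ = here refl
  b∈ : b ∈ a ∷ s
  b∈ = there (here refl)
  d∈ : d ∈ a ∷ s
  d∈ = there (there (here refl))
  same-turn : does (changesDirection? (f a) (f b) (f d)) ≡ does (changesDirection? a b d)
  same-turn
    rewrite up-reverses rev a∈ b∈ | up-reverses rev d∈ b∈ | up-reverses rev b∈ a∈ | up-reverses rev b∈ d∈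
    = ∨-comm (up b a ∧ up b d) _

changes-complement : {s : Vec (Fin n) k} → Unique s → changes (complement s) ≡ changes s
changes-complement u = changes-reverses (opposite-reverses u)

-- Counts the turns at the two inner entries of four consecutive ones whose three steps have
-- directions `α`, `β`, `γ`. For the entries at positions i - 2, ..., i + 1 these are the only turns
-- that `c i` can affect.
window : Bool → Bool → Bool → ℕ
window α β γ = turn α β ℕ.+ turn β γ

changes-window : {a b x y : Fin n} {s : Vec (Fin n) k} → Unique (a ∷ b ∷ x ∷ y ∷ s) →
                 changes (a ∷ b ∷ x ∷ y ∷ s) ≡ window (up a b) (up b x) (up x y) ℕ.+ changes (x ∷ y ∷ s)
changes-window {a = a} {b} {x} {y} {s} ((a≢b ∷ _) ∷ (b≢x ∷ _) ∷ (x≢y ∷ _) ∷ _) = begin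
  changes (a ∷ b ∷ x ∷ y ∷ s)
    ≡⟨ changes-∷ {s = y ∷ s} a≢b b≢x ⟩
  turn (up a b) (up b x) ℕ.+ changes (b ∷ x ∷ y ∷ s)
    ≡⟨ cong (turn (up a b) (up b x) ℕ.+_) (changes-∷ {s = s} b≢x x≢y) ⟩
  turn (up a b) (up b x) ℕ.+ (turn (up b x) (up x y) ℕ.+ changes (x ∷ y ∷ s))
    ≡⟨ ℕ.+-assoc (turn (up a b) (up b x)) _ _ ⟨
  window (up a b) (up b x) (up x y) ℕ.+ changes (x ∷ y ∷ s) ∎
  where open ≡-Reasoning

-- The step from `a` to `b` is kept, the step after `x` is reversed, and the tail keeps its number
-- of turns as a complemented word. Only the middle step depends on the actual value of `opposite`.
changes-complemented-window :
  {a b x y : Fin n} {s : Vec (Fin n) k} → Unique (a ∷ b ∷ x ∷ y ∷ s) →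
  changes (complementAfter 2 (a ∷ b ∷ x ∷ y ∷ s)) ≡
  window (up a b) (up b (opposite (x ∷ y ∷ s) x)) (not (up x y)) ℕ.+ changes (x ∷ y ∷ s)
changes-complemented-window {a = a} {b} {x} {y} {s} u@(_ ∷ _ ∷ v@((x≢y ∷ _) ∷ _)) = begin
  changes (a ∷ b ∷ complement t)
    ≡⟨ changes-window (complementAfter-unique 2 u) ⟩
  window (up a b) (up b x′) (up x′ (opposite t y)) ℕ.+ changes (complement t)
    ≡⟨ cong₂ (λ γ m → window (up a b) (up b x′) γ ℕ.+ m) flipped (changes-complement v) ⟩
  window (up a b) (up b x′) (not (up x y)) ℕ.+ changes t ∎
  where
  open ≡-Reasoning
  t = x ∷ y ∷ s
  x′ = opposite t x
  flipped : up x′ (opposite t y) ≡ not (up x y)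
  flipped = ≡.trans (up-reverses (opposite-reverses v) (here refl) (there (here refl))) (up-flip x≢y)

-- Change of the number of turns under one complementation

Adjacent : ℕ → ℕ → Set
Adjacent i j = j ≡ suc i ⊎ i ≡ suc j

adjacent-+ : ∀ m {i j} → Adjacent i j → Adjacent (i ℕ.+ m) (j ℕ.+ m)
adjacent-+ m = Sum.map (cong (ℕ._+ m)) (cong (ℕ._+ m))

-- Whether or not the direction β of the middle step changes, exactly one
-- of the two possible turns is created or destroyed.

window-adjacent : ∀ α β β′ γ → Adjacent (window α β γ) (window α β′ (not γ))
window-adjacent true  true  true  true  = inj₁ refl
window-adjacent true  true  true  false = inj₂ refl
window-adjacent true  true  false true  = inj₁ refl
window-adjacent true  true  false false = inj₁ refl
window-adjacent true  false true  true  = inj₂ refl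
window-adjacent true  false true  false = inj₂ refl
window-adjacent true  false false true  = inj₂ refl
window-adjacent true  false false false = inj₁ refl
window-adjacent false true  true  true  = inj₁ refl
window-adjacent false true  true  false = inj₂ refl
window-adjacent false true  false true  = inj₂ refl
window-adjacent false true  false false = inj₂ refl
window-adjacent false false true  true  = inj₁ refl
window-adjacent false false true  false = inj₁ refl
window-adjacent false false false true  = inj₂ refl
window-adjacent false false false false = inj₁ refl

-- Leading entries are stripped until only two precede the complemented suffix. The turn lost at
-- each stage involves three fixed entries, so it counts equally on both sides; `4 ℕ.+ l ≤ k` leaves
-- room for the window at the end.
complementAfter-adjacent : ∀ l {w : Vec (Fin n) k} → Unique w → 4 ℕ.+ l ≤ k →
                           Adjacent (changes w) (changes (complementAfter (2 ℕ.+ l) w))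
complementAfter-adjacent zero {_ ∷ []} _ (s≤s ())
complementAfter-adjacent zero {_ ∷ _ ∷ []} _ (s≤s (s≤s ()))
complementAfter-adjacent zero {_ ∷ _ ∷ _ ∷ []} _ (s≤s (s≤s (s≤s ())))
complementAfter-adjacent zero {a ∷ b ∷ x ∷ y ∷ s} u _ =
  subst₂ Adjacent (sym (changes-window u)) (sym (changes-complemented-window u))
    (adjacent-+ (changes (x ∷ y ∷ s)) (window-adjacent (up a b) (up b x) _ (up x y)))
complementAfter-adjacent (suc l) {_ ∷ []} _ (s≤s ())
complementAfter-adjacent (suc l) {_ ∷ _ ∷ []} _ (s≤s (s≤s ()))
complementAfter-adjacent (suc l) {a ∷ b ∷ d ∷ s} (_ ∷ u) (s≤s 4+l≤k)
  with does (changesDirection? a b d) | complementAfter-adjacent l u 4+l≤k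
... | true  | adj = Sum.map (cong suc) (cong suc) adj
... | false | adj = adj

-- Independence of complementations at different positions

Low : ℕ → Vec (Fin n) k → Set
Low l w = changes w < changes (complementAfter l w)

Low-∷ : ∀ l {a : Fin n} (w : Vec (Fin n) (2 ℕ.+ k)) → Low (3 ℕ.+ l) (a ∷ w) ⇔ Low (2 ℕ.+ l) w
Low-∷ l {a} (b ∷ d ∷ s) with does (changesDirection? a b d)
... | true  = mk⇔ s<s⁻¹ s<s
... | false = mk⇔ (λ p → p) (λ p → p)

-- The later complementation fixes all four entries of the window and permutes the values of the
-- suffix starting at `x`. Hence `opposite` sends `x` to the same value, and both windows being
-- compared stay as they are.
Low-later : ∀ {l l′} {w : Vec (Fin n) k} → Unique w → 4 ℕ.+ l ≤ k → 2 ℕ.+ l ≤ l′ →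
            Low (2 ℕ.+ l) w → Low (2 ℕ.+ l) (complementAfter (2 ℕ.+ l′) w)
Low-later {l = zero} {w = _ ∷ []} _ (s≤s ()) _ _
Low-later {l = zero} {w = _ ∷ _ ∷ []} _ (s≤s (s≤s ())) _ _
Low-later {l = zero} {w = _ ∷ _ ∷ _ ∷ []} _ (s≤s (s≤s (s≤s ()))) _ _
Low-later {l = zero} {suc (suc d)} {a ∷ b ∷ x ∷ y ∷ s} u@(_ ∷ _ ∷ v) _ (s≤s (s≤s _)) low =
  subst₂ _<_ (sym (changes-window u₁)) (sym (changes-complemented-window u₁))
    -- The old tail contributes equally to both sides of `low`; it is cancelled, leaving a
    -- comparison of windows, and the new tail is added instead.
    (ℕ.+-monoˡ-< (changes (x ∷ y ∷ complementAfter d s))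
      (subst (λ x′ → window (up a b) (up b x) (up x y) < window (up a b) (up b x′) (not (up x y)))
        (sym (opposite-complementAfter (2 ℕ.+ d) v (here refl)))
        (ℕ.+-cancelʳ-< (changes (x ∷ y ∷ s)) _ _
          (subst₂ _<_ (changes-window u) (changes-complemented-window u) low))))
  where
  u₁ = complementAfter-unique (4 ℕ.+ d) u
Low-later {l = suc l} {w = _ ∷ []} _ (s≤s ()) _ _
Low-later {l = suc l} {w = _ ∷ _ ∷ []} _ (s≤s (s≤s ())) _ _
Low-later {l = suc l} {suc l′} {a ∷ w@(_ ∷ _ ∷ _)} (_ ∷ u) (s≤s 4+l≤k) (s≤s 2+l≤l′) low =
  Equivalence.from (Low-∷ l (complementAfter (2 ℕ.+ l′) w))
    (Low-later u 4+l≤k 2+l≤l′ (Equivalence.to (Low-∷ l w) low))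

-- Complementing the whole word preserves turns and commutes with `complementAfter l`, so neither
-- side of the inequality changes.
Low-complement : ∀ l {w : Vec (Fin n) k} → Unique w → Low l w → Low l (complement w)
Low-complement l {w} u = subst₂ _<_ (sym (changes-complement u)) (begin
  changes (complementAfter l w)              ≡⟨ changes-complement (complementAfter-unique l u) ⟨
  changes (complement (complementAfter l w)) ≡⟨ cong changes (complement-commutes l u) ⟩
  changes (complementAfter l (complement w)) ∎)
  where open ≡-Reasoning

-- Once the `d` fixed entries are stripped, the earlier complementation acts on the whole word and
-- `Low-complement` applies. The bound `2 ℕ.+ d ≤ l` lets `Low-∷` remove each of these entries.
Low-earlier : ∀ {l d} {w : Vec (Fin n) k} → Unique w → 2 ℕ.+ d ≤ l → 2 ℕ.+ d ≤ k →
              Low l w → Low l (complementAfter d w)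
Low-earlier {l = l} {zero} u _ _ low = Low-complement l u low
Low-earlier {d = suc d} {w = _ ∷ []} _ _ (s≤s ()) _
Low-earlier {d = suc d} {w = _ ∷ _ ∷ []} _ _ (s≤s (s≤s ())) _
Low-earlier {l = suc (suc (suc l))} {suc d} {a ∷ w@(_ ∷ _ ∷ _)} (_ ∷ u) (s≤s 2+d≤l) (s≤s 2+d≤k) low =
  Equivalence.from (Low-∷ l (complementAfter d w))
    (Low-earlier u 2+d≤l 2+d≤k (Equivalence.to (Low-∷ l w) low))
Low-earlier {l = suc (suc zero)} {suc d} _ (s≤s (s≤s ()))

-- Polynomial sums over lists

∑-↭ : {xs ys : List A} (f : A → Poly) → xs ↭ ys → ∑ xs f ≋ ∑ ys f
∑-↭ f refl       = ≋.refl
∑-↭ f (prep x p) = +ₚ-congˡ (f x) (∑-↭ f p)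
∑-↭ {xs = _ ∷ _ ∷ xs} {_ ∷ _ ∷ ys} f (swap x y p) = begin
  f x + (f y + ∑ xs f)   ≈⟨ +ₚ-congˡ (f x) (+ₚ-congˡ (f y) (∑-↭ f p)) ⟩
  f x + (f y + ∑ ys f)   ≈⟨ x∙yz≈y∙xz (f x) (f y) _ ⟩
  f y + (f x + ∑ ys f)   ∎
  where open SetoidReasoning ≋-setoid
∑-↭ f (trans p q) = ≋.trans (∑-↭ f p) (∑-↭ f q)

-- Without repetitions, equal membership already makes the two lists permutations of each other.
∑-unique : {xs ys : List A} (f : A → Poly) → Uniqueₗ xs → Uniqueₗ ys →
           (∀ {x} → x ∈ₗ xs ⇔ x ∈ₗ ys) → ∑ xs f ≋ ∑ ys f
∑-unique f xs! ys! xs∼ys = ∑-↭ f (∼bag⇒↭ (unique∧set⇒bag xs! ys! xs∼ys))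

∑-map : (g : A → B) (f : B → Poly) (xs : List A) → ∑ (List.map g xs) f ≡ ∑ xs (f ∘ g)
∑-map g f xs = cong (List.foldr _+_ 0#) (sym (mapₗ-∘ xs))

∑-cong : {f g : A → Poly} (xs : List A) → (∀ {x} → x ∈ₗ xs → f x ≋ g x) → ∑ xs f ≋ ∑ xs g
∑-cong []       f≋g = ≋.refl
∑-cong (x ∷ xs) f≋g = +ₚ-cong (f≋g (here refl)) (∑-cong xs (f≋g ∘ there))

∑-*ˡ : (a : Poly) (f : A → Poly) (xs : List A) → ∑ xs (λ x → a * f x) ≋ a * ∑ xs f
∑-*ˡ a f []       = ≋.sym (ℤ[z].zeroʳ a)
∑-*ˡ a f (x ∷ xs) = ≋.trans (+ₚ-congˡ (a * f x) (∑-*ˡ a f xs)) (≋.sym (ℤ[z].distribˡ a (f x) _))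

∑-filter : {P : Pred A 0ℓ} (P? : Decidable P) (f : A → Poly) (xs : List A) →
           ∑ xs f ≋ ∑ (filter P? xs) f + ∑ (filter (¬? ∘ P?) xs) f
∑-filter P? f [] = ≋.refl
∑-filter P? f (x ∷ xs) with P? x
... | yes _ = ≋.trans (+ₚ-congˡ (f x) (∑-filter P? f xs)) (≋.sym (+ₚ-assoc (f x) _ _))
... | no  _ = ≋.trans (+ₚ-congˡ (f x) (∑-filter P? f xs)) (x∙yz≈y∙xz (f x) (∑ (filter P? xs) f) _)

-- Splitting off a factor by a pairing

adjacent-≮ : ∀ {i j} → Adjacent i j → ¬ i < j → i ≡ suc j
adjacent-≮ (inj₁ refl) i≮j = contradiction ℕ.≤-refl i≮j
adjacent-≮ (inj₂ eq)   _   = eq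

adjacent-< : ∀ {i j} → Adjacent i j → i < j → j ≡ suc i
adjacent-< (inj₁ eq)   _   = eq
adjacent-< (inj₂ refl) i<j = contradiction (ℕ.n≤1+n _) (ℕ.<⇒≱ i<j)

-- Each pair `x`, `σ x` has exactly one member of lower `ρ`, and the other contributes `z` times as
-- much. The higher members are thus the image under `σ` of the lower ones.
∑-involution : (ρ : A → ℕ) (σ : A → A) → (∀ x → σ (σ x) ≡ x) → (∀ x → Adjacent (ρ x) (ρ (σ x))) →
               {xs : List A} → Uniqueₗ xs → (∀ {x} → x ∈ₗ xs → σ x ∈ₗ xs) →
               ∑ xs (λ x → z ^ ρ x) ≋
               (1# + z) * ∑ (filter (λ x → ρ x <? ρ (σ x)) xs) (λ x → z ^ ρ x)
∑-involution {A} ρ σ σσ adj {xs} xs! closed = begin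
  ∑ xs f                          ≈⟨ ∑-filter lower? f xs ⟩
  ∑ ls f + ∑ hs f                 ≈⟨ +ₚ-congˡ (∑ ls f) (∑-unique f hs! σls! hs∼σls) ⟩
  ∑ ls f + ∑ (List.map σ ls) f    ≡⟨ cong (∑ ls f +_) (∑-map σ f ls) ⟩
  ∑ ls f + ∑ ls (f ∘ σ)           ≈⟨ +ₚ-congˡ (∑ ls f) (∑-cong ls raise) ⟩
  ∑ ls f + ∑ ls (λ x → z * f x)   ≈⟨ +ₚ-cong (ℤ[z].*-identityˡ _) (≋.sym (∑-*ˡ z f ls)) ⟨
  1# * ∑ ls f + z * ∑ ls f        ≈⟨ ℤ[z].distribʳ (∑ ls f) 1# z ⟨
  (1# + z) * ∑ ls f               ∎
  where
  open SetoidReasoning ≋-setoid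
  f : A → Poly
  f x = z ^ ρ x
  lower? = λ x → ρ x <? ρ (σ x)
  ls = filter lower? xs
  hs = filter (¬? ∘ lower?) xs
  σ-injective : ∀ {x y} → σ x ≡ σ y → x ≡ y
  σ-injective {x} {y} eq = ≡.trans (sym (σσ x)) (≡.trans (cong σ eq) (σσ y))
  hs! = Uniqueₗ.filter⁺ (¬? ∘ lower?) xs!
  σls! = Uniqueₗ.map⁺ σ-injective (Uniqueₗ.filter⁺ lower? xs!)
  raise : ∀ {x} → x ∈ₗ ls → f (σ x) ≋ z * f x
  raise {x} x∈ = ≋.reflexive (cong (z ^_) (adjacent-< (adj x) (proj₂ (∈-filter⁻ lower? {xs = xs} x∈))))
  hs∼σls : ∀ {x} → x ∈ₗ hs ⇔ x ∈ₗ List.map σ ls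
  hs∼σls {x} = mk⇔ to from
    where
    to : x ∈ₗ hs → x ∈ₗ List.map σ ls
    to x∈hs with x∈xs , ρx≮ρσx ← ∈-filter⁻ (¬? ∘ lower?) {xs = xs} x∈hs =
      -- An `x` that is not lower exceeds `σ x` by exactly one, so `σ x` is a lower element, and its
      -- image under `σ` is `x`.
      subst (_∈ₗ List.map σ ls) (σσ x) (∈-map⁺ σ (∈-filter⁺ lower? (closed x∈xs)
        (subst (λ y → ρ (σ x) < ρ y) (sym (σσ x)) (ℕ.≤-reflexive (sym (adjacent-≮ (adj x) ρx≮ρσx))))))
    from : x ∈ₗ List.map σ ls → x ∈ₗ hs
    from x∈ with y , y∈ls , refl ← ∈-map⁻ σ x∈
            with y∈xs , ρy<ρσy ← ∈-filter⁻ lower? {xs = xs} y∈ls =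
      ∈-filter⁺ (¬? ∘ lower?) (closed y∈xs) (subst (λ w → ¬ ρ (σ y) < ρ w) (sym (σσ y)) (ℕ.<-asym ρy<ρσy))

-- Permutations, indices and orbits

∈-words : (w : Vec (Fin n) k) → w ∈ₗ words n k
∈-words []      = here refl
∈-words (x ∷ w) = ∈-cartesianProductWith⁺ _∷_ (∈-allFin x) (∈-words w)

words-unique : ∀ n k → Uniqueₗ (words n k)
words-unique n zero    = [] ∷ []
words-unique n (suc k) =
  Uniqueₗ.cartesianProductWith⁺ _∷_ Vec.∷-injective (Uniqueₗ.allFin⁺ n) (words-unique n k)

-- Transfers questions about `perms` to a filtered list of words, where repetition and membership
-- are easy to control; a permutation is determined by its word.
map-word-mapMaybe-toPerm : (ws : List (Vec (Fin n) n)) →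
                           List.map word (List.mapMaybe toPerm ws) ≡ filter unique? ws
map-word-mapMaybe-toPerm [] = refl
map-word-mapMaybe-toPerm (w ∷ ws) with unique? w
... | yes _ = cong (w ∷_) (map-word-mapMaybe-toPerm ws)
... | no  _ = map-word-mapMaybe-toPerm ws

perms-unique : ∀ n → Uniqueₗ (perms n)
perms-unique n = Uniqueₗ.map⁻ (subst Uniqueₗ (sym (map-word-mapMaybe-toPerm (words n n)))
  (Uniqueₗ.filter⁺ unique? (words-unique n n)))

∈-perms : (p : Perm n) → p ∈ₗ perms n
∈-perms {n} p
  with q , q∈ , eq ← ∈-map⁻ word (subst (word p ∈ₗ_) (sym (map-word-mapMaybe-toPerm (words n n)))
                       (∈-filter⁺ unique? (∈-words (word p)) (isUnique p)))
  = subst (_∈ₗ perms n) (sym (perm-≡ eq)) q∈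

even⊎odd : ∀ i → (∃[ q ] i ≡ q ℕ.* 2) ⊎ (∃[ q ] i ≡ suc (q ℕ.* 2))
even⊎odd zero = inj₁ (0 , refl)
even⊎odd (suc i) with even⊎odd i
... | inj₁ (q , eq) = inj₂ (q , cong suc eq)
... | inj₂ (q , eq) = inj₁ (suc q , cong suc eq)

index : ℕ → ℕ
index j = 3 ℕ.+ j ℕ.* 2

odd≥3⇒index : ∀ {i} → 3 ≤ i → ¬ 2 ∣ₙ i → ∃[ j ] i ≡ index j
odd≥3⇒index {i} 3≤i 2∤i with even⊎odd i
... | inj₁ (q , eq)       = contradiction (divides q eq) 2∤i
... | inj₂ (zero , refl)  = contradiction 3≤i λ { (s≤s ()) }
... | inj₂ (suc j , eq)   = j , eq

odd≢even : ∀ p q → suc (p ℕ.* 2) ≢ q ℕ.* 2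
odd≢even (suc p) (suc q) eq = odd≢even p q (ℕ.suc-injective (ℕ.suc-injective eq))

2∤index : ∀ j → ¬ 2 ∣ₙ index j
2∤index j (divides q eq) = odd≢even (suc j) q eq

∈𝒞⇒index : ∀ {i} → i ∈𝒞 n → ∃[ j ] i ≡ index j × index j < n
∈𝒞⇒index {zero}  (even _ 3≤i _ i≤0) = contradiction (ℕ.≤-trans 3≤i i≤0) λ ()
∈𝒞⇒index {zero}  (odd  _ 3≤i _ i≤0) = contradiction (ℕ.≤-trans 3≤i i≤0) λ ()
∈𝒞⇒index {suc n} (even _ 3≤i 2∤i i≤) with j , refl ← odd≥3⇒index 3≤i 2∤i = j , refl , s≤s i≤
∈𝒞⇒index {suc n} (odd  _ 3≤i 2∤i i≤) with j , refl ← odd≥3⇒index 3≤i 2∤i =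
  j , refl , s≤s (ℕ.≤-trans i≤ (ℕ.m∸n≤m n 1))

-- One strict bound serves both parities of `n`. For odd `n`, where the stated bound is `n ∸ 2`, an
-- odd index cannot equal `n ∸ 1`, since `n` would then be even.
index⇒∈𝒞 : ∀ j → index j < n → index j ∈𝒞 n
index⇒∈𝒞 {suc n} j (s≤s i≤n) with 2 ∣? suc n
... | yes 2∣n = even 2∣n (s≤s (s≤s (s≤s z≤n))) (2∤index j) i≤n
... | no  2∤n = odd 2∤n (s≤s (s≤s (s≤s z≤n))) (2∤index j) (ℕ.<⇒≤pred (ℕ.≤∧≢⇒< i≤n
  λ { refl → 2∤n (divides (2 ℕ.+ j) refl) }))

-- After subtracting 2, the condition `index j < n` reads 2(j + 1) ≤ n - 2. This is how the exponent
-- m of the theorem counts the generators.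
index<⇔ : ∀ {j n} → index j < n ⇔ j < (n ∸ 2) / 2
index<⇔ {j} {n} = mk⇔ to (from n)
  where
  to : index j < n → j < (n ∸ 2) / 2
  to i<n = subst (_≤ (n ∸ 2) / 2) (m*n/n≡m (suc j) 2) (/-monoˡ-≤ 2 (ℕ.∸-monoˡ-≤ 2 i<n))
  from : ∀ n → j < (n ∸ 2) / 2 → index j < n
  from (suc (suc n)) j< = s≤s (s≤s (ℕ.≤-trans (ℕ.*-monoˡ-≤ 2 j<) (m/n*n≤m n 2)))

LowAt : ℕ → Perm n → Set
LowAt i p = run p < run (c i p)

c-adjacent : ∀ {i} → i ∈𝒞 n → (p : Perm n) → Adjacent (run p) (run (c i p))
c-adjacent i∈ p with j , refl , i<n ← ∈𝒞⇒index i∈ =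
  -- `index j ∸ 1` is `2 ℕ.+ j ℕ.* 2`, and `i<n` unfolds to the required `4 ℕ.+ j ℕ.* 2 ≤ n`.
  Sum.map (cong suc) (cong suc) (complementAfter-adjacent (j ℕ.* 2) (isUnique p) i<n)

-- Distinct indices in 𝒞 differ by at least two. So `c i′` either starts beyond position i + 1, or
-- starts at position i - 2 or before and complements the whole window.
LowAt-c : ∀ {i i′} → i ∈𝒞 n → i′ ∈𝒞 n → i ≢ i′ → (p : Perm n) → LowAt i p → LowAt i (c i′ p)
LowAt-c i∈ i′∈ i≢i′ p low
  with j , refl , i<n ← ∈𝒞⇒index i∈ | j′ , refl , i′<n ← ∈𝒞⇒index i′∈ | ℕ.<-cmp j j′
... | tri< j<j′ _ _ = s<s (Low-later (isUnique p) i<n (ℕ.*-monoˡ-≤ 2 j<j′) (s<s⁻¹ low))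
... | tri≈ _ refl _ = contradiction refl i≢i′
... | tri> _ _ j′<j =
  s<s (Low-earlier (isUnique p) (s≤s (s≤s (ℕ.*-monoˡ-≤ 2 j′<j))) i′<n (s<s⁻¹ low))

-- The number of runs changes by exactly one under `c i`, and a decrease would give an orbit element
-- with fewer runs.
minimal⇒LowAt : {q : Perm n} → Minimal q → ∀ {i} → i ∈𝒞 n → LowAt i q
minimal⇒LowAt {q = q} min {i} i∈ with c-adjacent i∈ q
... | inj₁ eq = ℕ.≤-reflexive (sym eq)
... | inj₂ eq = contradiction (min (c i q) (c i , generator i∈ , refl)) (ℕ.<⇒≱ (ℕ.≤-reflexive (sym eq)))

LowAt-translates : ∀ {i} is → i ∈𝒞 n → Allₗ (_∈𝒞 n) is → Allₗ (i ≢_) is →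
                   {q r : Perm n} → LowAt i q → r ∈ₗ translates is q → LowAt i r
LowAt-translates []        i∈ []          []            low (here refl) = low
LowAt-translates (i′ ∷ is) i∈ (i′∈ ∷ is∈) (i≢i′ ∷ i∉is) {q} low r∈
  with ∈-++⁻ (translates is q) r∈
... | inj₁ r∈′ = LowAt-translates is i∈ is∈ i∉is low r∈′
... | inj₂ r∈′ with s , s∈ , refl ← ∈-map⁻ (c i′) r∈′ =
  LowAt-c i∈ i′∈ i≢i′ s (LowAt-translates is i∈ is∈ i∉is low s∈)

-- The generators are applied one at a time. Each meets a translate by generators of other indices,
-- which is still low at its own index, so the number of runs rises at every application.
run-≤-translates : ∀ is → Allₗ (_∈𝒞 n) is → Uniqueₗ is → {q r : Perm n} →
                   Allₗ (λ i → LowAt i q) is → r ∈ₗ translates is q → run q ≤ run r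
run-≤-translates []       []         []         []           (here refl) = ℕ.≤-refl
run-≤-translates (i ∷ is) (i∈ ∷ is∈) (i∉is ∷ u) {q} (low ∷ lows) r∈
  with ∈-++⁻ (translates is q) r∈
... | inj₁ r∈′ = run-≤-translates is is∈ u lows r∈′
... | inj₂ r∈′ with s , s∈ , refl ← ∈-map⁻ (c i) r∈′ =
  ℕ.≤-trans (run-≤-translates is is∈ u lows s∈)
            (ℕ.<⇒≤ (LowAt-translates is i∈ is∈ i∉is low s∈))

LowAt⇒minimal : {q : Perm n} → (∀ {i} → i ∈𝒞 n → LowAt i q) → Minimal q
LowAt⇒minimal {n} low r r∈ =
  run-≤-translates (indices n) indices⊆𝒞 (Uniqueₗ.filter⁺ (_∈𝒞? n) (Uniqueₗ.upTo⁺ (suc n)))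
    (Allₗ.map low indices⊆𝒞) (orbit-complete r∈)
  where
  indices⊆𝒞 : Allₗ (_∈𝒞 n) (indices n)
  indices⊆𝒞 = Allₗ.all-filter (_∈𝒞? n) (List.upTo (suc n))

-- Factorisation of the generating function

weight : Perm n → Poly
weight p = z ^ run p

-- One pairing per index: the permutations low at `i` remain, and by `LowAt-c` they are still closed
-- under the other generators, so the induction continues on them. Describing `qs` only by
-- membership allows the minimal permutations to be put in its place.
∑-factor : (is : List ℕ) → Allₗ (_∈𝒞 n) is → Uniqueₗ is → {ps qs : List (Perm n)} →
           Uniqueₗ ps → Uniqueₗ qs → (∀ {i p} → i ∈ₗ is → p ∈ₗ ps → c i p ∈ₗ ps) →
           (∀ {p} → p ∈ₗ qs ⇔ (p ∈ₗ ps × Allₗ (λ i → LowAt i p) is)) →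
           ∑ ps weight ≋ (1# + z) ^ length is * ∑ qs weight
∑-factor [] [] [] {ps} {qs} ps! qs! closed qs⇔ = ≋.trans
  (∑-unique weight ps! qs! (mk⇔ (λ p∈ → Equivalence.from qs⇔ (p∈ , [])) (proj₁ ∘ Equivalence.to qs⇔)))
  (≋.sym (ℤ[z].*-identityˡ _))
∑-factor {n} (i ∷ is) (i∈ ∷ is∈) (i∉is ∷ is!) {ps} {qs} ps! qs! closed qs⇔ = begin
  ∑ ps weight
    ≈⟨ ∑-involution run (c i) (c-involutive i) (c-adjacent i∈) ps! (closed (here refl)) ⟩
  (1# + z) * ∑ ls weight
    ≈⟨ *ₚ-congˡ (1# + z) (∑-factor is is∈ is! (Uniqueₗ.filter⁺ low? ps!) qs! closed′ (mk⇔ to from)) ⟩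
  (1# + z) * ((1# + z) ^ length is * ∑ qs weight)
    ≈⟨ *ₚ-assoc (1# + z) ((1# + z) ^ length is) (∑ qs weight) ⟨
  (1# + z) ^ suc (length is) * ∑ qs weight ∎
  where
  open SetoidReasoning ≋-setoid
  low? : Decidable (LowAt {n} i)
  low? p = run p <? run (c i p)
  ls = filter low? ps
  closed′ : ∀ {i′ p} → i′ ∈ₗ is → p ∈ₗ ls → c i′ p ∈ₗ ls
  closed′ {i′} {p} i′∈ p∈ with p∈ps , low ← ∈-filter⁻ low? {xs = ps} p∈ =
    ∈-filter⁺ low? (closed (there i′∈) p∈ps)
      (LowAt-c i∈ (Allₗ.lookup is∈ i′∈) (Allₗ.lookup i∉is i′∈) p low)
  to : ∀ {p} → p ∈ₗ qs → p ∈ₗ ls × Allₗ (λ i → LowAt i p) is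
  to p∈ with p∈ps , low ∷ lows ← Equivalence.to qs⇔ p∈ = ∈-filter⁺ low? p∈ps low , lows
  from : ∀ {p} → p ∈ₗ ls × Allₗ (λ i → LowAt i p) is → p ∈ₗ qs
  from (p∈ , lows) with p∈ps , low ← ∈-filter⁻ low? {xs = ps} p∈ = Equivalence.from qs⇔ (p∈ps , low ∷ lows)

R-factor : ∀ n → R n ≋ (1# + z) ^ ((n ∸ 2) / 2) * ∑ (filter minimal? (perms n)) weight
R-factor n = subst (λ m → R n ≋ (1# + z) ^ m * ∑ (filter minimal? (perms n)) weight)
  (length-applyUpTo index ((n ∸ 2) / 2))
  (∑-factor is is⊆𝒞 is! (perms-unique n) (Uniqueₗ.filter⁺ minimal? (perms-unique n))
    (λ _ _ → ∈-perms _) (mk⇔ to from))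
  where
  -- The same set as `indices n`, but enumerated so that its length, which becomes the exponent, is
  -- known.
  is = applyUpTo index ((n ∸ 2) / 2)
  is⊆𝒞 : Allₗ (_∈𝒞 n) is
  is⊆𝒞 = Allₗ.applyUpTo⁺₁ index _ (λ {j} j< → index⇒∈𝒞 j (Equivalence.from index<⇔ j<))
  𝒞⊆is : ∀ {i} → i ∈𝒞 n → i ∈ₗ is
  𝒞⊆is i∈ with j , refl , i<n ← ∈𝒞⇒index i∈ = ∈-applyUpTo⁺ index (Equivalence.to (index<⇔ {j}) i<n)
  is! : Uniqueₗ is
  is! = Uniqueₗ.applyUpTo⁺₁ index _ (λ {i} {j} i<j _ → ℕ.<⇒≢ (ℕ.+-monoʳ-< 3 (ℕ.*-monoˡ-< 2 {i} {j} i<j)))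
  to : ∀ {p} → p ∈ₗ filter minimal? (perms n) → p ∈ₗ perms n × Allₗ (λ i → LowAt i p) is
  to p∈ with p∈perms , min ← ∈-filter⁻ minimal? {xs = perms n} p∈ =
    p∈perms , Allₗ.map (minimal⇒LowAt min) is⊆𝒞
  from : ∀ {p} → p ∈ₗ perms n × Allₗ (λ i → LowAt i p) is → p ∈ₗ filter minimal? (perms n)
  from (p∈perms , lows) = ∈-filter⁺ minimal? p∈perms (LowAt⇒minimal (λ i∈ → Allₗ.lookup lows (𝒞⊆is i∈)))

mainTheorem4 : (n : ℕ) → 4 ≤ n →
    (R n ≈ (1# + z) ^ ((n ∸ 2) / 2) * ∑ (filter minimal? (perms n)) (λ q → z ^ run q))
    × ((1# + z) ^ ((n ∸ 2) / 2) ∣ R n)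
mainTheorem4 n _ =
    coeff-≡ (R-factor n)
  -- Divisibility puts the cofactor `S` on the left of the divisor, hence the use of commutativity.
  , (S , coeff-≡ (≋.trans (*ₚ-comm S _) (≋.sym (R-factor n))))
  where
  S = ∑ (filter minimal? (perms n)) weight
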